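{- A 4-tuple of numbers $(t;p_1,p_2,p_3)$ (with the $p_i$ unordered) is the symbol of some three-card hand of the 81-card SET deck if and only if all of the following hold: \begin{align*} t&\in\{0,1,2,3\},\\ p_i&\in\{0,1,2,3\}\quad\text{for each } i\in\{1,2,3\},\\ p_i+t&\in\{0,1,2,3\}\quad\text{for each } i\in\{1,2,3\},\\ t+p_1+p_2+p_3&\in\{0,1,2,3,4\}. \end{align*}
   Context: **Deck.** Let $A=\{\text{color},\text{shape},\text{fill},\text{number}\}$ be the set of four attributes. For each $a\in A$ let $V_a$ be the set of three values of attribute $a$: $V_{\text{color}}=\{\text{red, green, purple}\}$, $V_{\text{shape}}=\{\text{oval, diamond, squiggle}\}$, $V_{\text{fill}}=\{\text{solid, empty, stripe}\}$, $V_{\text{number}}=\{\text{single, double, triple}\}$. The SET deck consists of $3^4=81$ cards, exactly one for each choice of a value in each attribute (that is, the deck is identified with $\prod_{a\in A}V_a$). For a card $x$ and $a\in A$, $v_a(x)\in V_a$ denotes the value of $x$ for attribute $a$. A hand is a subset of the deck; a three-card hand is a subset with exactly three elements. **Symbol.** Let $H=\{x_1,x_2,x_3\}$ be a hand with exactly three cards. Its symbol is $(t;p_1,p_2,p_3)$, where the $p_i$'s are unordered (i.e. $\{p_1,p_2,p_3\}$ is regarded as a multiset). Here $t$ is the number of attributes $a\in A$ on which all three cards have the same value, and the $p_i$'s are, for each of the three pairs of cards of $H$, the number of attributes on which the two cards of that pair have the same value but which are not among the $t$ attributes common to all three cards. -}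

module Defs where

open import Data.List using (List; []; _∷_; length; filter)
open import Data.List.Membership.Propositional using (_∈_)
open import Data.List.Relation.Binary.Permutation.Propositional using (_↭_)
open import Data.List.Relation.Unary.Unique.Propositional using (Unique)
open import Data.Nat using (ℕ)
open import Data.Product using (_×_)
open import Level using (0ℓ)
open import Relation.Binary.Definitions using (DecidableEquality)
open import Relation.Binary.PropositionalEquality using (_≡_; refl)
open import Relation.Nullary using (¬_; yes; no; ¬?; _×-dec_)
open import Relation.Unary using (Pred; Decidable; _≐_)

data Attribute : Set where
  color shape fill number : Attribute

attributes : List Attribute
attributes = color ∷ shape ∷ fill ∷ number ∷ []

data Color : Set where
  red green purple : Color

data Shape : Set where
  oval diamond squiggle : Shape

data Fill : Set where
  solid empty stripe : Fill

data Number : Set where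
  single double triple : Number

V : Attribute → Set
V color  = Color
V shape  = Shape
V fill   = Fill
V number = Number

-- A record rather than a function (a : Attribute) → V a: without function
-- extensionality, cards agreeing on every attribute could not be shown equal.
record Card : Set where
  constructor card
  field
    colorOf  : Color
    shapeOf  : Shape
    fillOf   : Fill
    numberOf : Number

open Card public

v : (a : Attribute) → Card → V a
v color  = colorOf
v shape  = shapeOf
v fill   = fillOf
v number = numberOf

_≟Color_ : DecidableEquality Color
red    ≟Color red    = yes refl
red    ≟Color green  = no λ ()
red    ≟Color purple = no λ ()
green  ≟Color red    = no λ ()
green  ≟Color green  = yes refl
green  ≟Color purple = no λ ()
purple ≟Color red    = no λ ()
purple ≟Color green  = no λ ()
purple ≟Color purple = yes refl

_≟Shape_ : DecidableEquality Shape
oval     ≟Shape oval     = yes refl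
oval     ≟Shape diamond  = no λ ()
oval     ≟Shape squiggle = no λ ()
diamond  ≟Shape oval     = no λ ()
diamond  ≟Shape diamond  = yes refl
diamond  ≟Shape squiggle = no λ ()
squiggle ≟Shape oval     = no λ ()
squiggle ≟Shape diamond  = no λ ()
squiggle ≟Shape squiggle = yes refl

_≟Fill_ : DecidableEquality Fill
solid  ≟Fill solid  = yes refl
solid  ≟Fill empty  = no λ ()
solid  ≟Fill stripe = no λ ()
empty  ≟Fill solid  = no λ ()
empty  ≟Fill empty  = yes refl
empty  ≟Fill stripe = no λ ()
stripe ≟Fill solid  = no λ ()
stripe ≟Fill empty  = no λ ()
stripe ≟Fill stripe = yes refl

_≟Number_ : DecidableEquality Number
single ≟Number single = yes refl
single ≟Number double = no λ ()
single ≟Number triple = no λ ()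
double ≟Number single = no λ ()
double ≟Number double = yes refl
double ≟Number triple = no λ ()
triple ≟Number single = no λ ()
triple ≟Number double = no λ ()
triple ≟Number triple = yes refl

≟V : (a : Attribute) → DecidableEquality (V a)
≟V color  = _≟Color_
≟V shape  = _≟Shape_
≟V fill   = _≟Fill_
≟V number = _≟Number_

Agree : Card → Card → Pred Attribute 0ℓ
Agree x y a = v a x ≡ v a y

agree? : ∀ x y → Decidable (Agree x y)
agree? x y a = ≟V a (v a x) (v a y)

AllAgree : Card → Card → Card → Pred Attribute 0ℓ
AllAgree x y z a = Agree x y a × Agree y z a

allAgree? : ∀ x y z → Decidable (AllAgree x y z)
allAgree? x y z a = agree? x y a ×-dec agree? y z a

-- x and y agree, but the three cards x, y, z do not.
OnlyPairAgrees : Card → Card → Card → Pred Attribute 0ℓ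
OnlyPairAgrees x y z a = Agree x y a × ¬ AllAgree x y z a

onlyPairAgrees? : ∀ x y z → Decidable (OnlyPairAgrees x y z)
onlyPairAgrees? x y z a = agree? x y a ×-dec ¬? (allAgree? x y z a)

#_ : {P : Pred Attribute 0ℓ} → Decidable P → ℕ
# P? = length (filter P? attributes)

record Symbol : Set where
  constructor ⟨_⨾_⨾_⨾_⟩
  field
    t p₁ p₂ p₃ : ℕ

  ps : List ℕ
  ps = p₁ ∷ p₂ ∷ p₃ ∷ []

-- The p's are unordered, so they are compared as a multiset.
infix 4 _≈_
_≈_ : Symbol → Symbol → Set
s ≈ s′ = Symbol.t s ≡ Symbol.t s′ × Symbol.ps s ↭ Symbol.ps s′

Hand : Set₁
Hand = Pred Card 0ℓ

record HasThreeCards (H : Hand) : Set where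
  field
    x₁ x₂ x₃ : Card
    distinct : Unique (x₁ ∷ x₂ ∷ x₃ ∷ [])
    elements : H ≐ (_∈ x₁ ∷ x₂ ∷ x₃ ∷ [])

-- Listing the cards of H in another order gives the same symbol up to _≈_.
symbol : (H : Hand) → HasThreeCards H → Symbol
symbol H h =
  ⟨ # allAgree? x₁ x₂ x₃
  ⨾ # onlyPairAgrees? x₁ x₂ x₃
  ⨾ # onlyPairAgrees? x₁ x₃ x₂
  ⨾ # onlyPairAgrees? x₂ x₃ x₁
  ⟩
  where open HasThreeCards h

{-# OPTIONS --safe #-}
-- Of the at most four attributes, each is counted at most once among t, p₁, p₂, p₃,
-- and pᵢ + t counts attributes on which two different cards agree, so it is at
-- most 3. Conversely, let t attributes take the values (0,0,0) on the three
-- cards, pᵢ of them the values on which only the i-th pair agrees, and the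
-- remaining ones (0,1,2); pᵢ + t ≤ 3 makes these cards distinct.
module Submission where

open import Defs
open import Data.Fin using (Fin)
open import Data.Fin.Patterns using (0F; 1F; 2F)
open import Data.List using (List; []; _∷_; _++_; filter; length; replicate; upTo)
open import Data.List.Membership.Propositional using (_∈_)
open import Data.List.Membership.Propositional.Properties using (∈-upTo⁺)
open import Data.List.Properties using (filter-notAll; length-filter)
open import Data.List.Relation.Binary.Permutation.Propositional using (↭-reflexive)
open import Data.List.Relation.Binary.Permutation.Propositional.Properties using (All-resp-↭)
open import Data.List.Relation.Unary.All as All using (All; []; _∷_; all?)
open import Data.List.Relation.Unary.All.Properties using (¬All⇒Any¬)
open import Data.List.Relation.Unary.AllPairs using ([]; _∷_)
open import Data.List.Relation.Unary.Unique.Propositional using (Unique)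
open import Data.Nat using (ℕ; _+_; _≤_; _<_; z≤n; s≤s; _≟_)
open import Data.Nat.ListAction.Properties using (sum-↭)
open import Data.Nat.Properties
  using (≤-trans; ≤-reflexive; ≤-<-trans; m≤n⇒m≤1+n; +-suc; +-monoˡ-≤; m≤m+n; m≤n+m)
open import Data.Nat.Tactic.RingSolver using (solve-∀)
open import Data.Product using (Σ-syntax; _×_; _,_; proj₁; proj₂)
open import Data.Sum using (inj₁; inj₂; [_,_]′)
open import Data.Vec using ([]; _∷_; lookup)
open import Function using (id)
open import Function.Bundles using (_⇔_; mk⇔)
open import Level using (0ℓ)
open import Relation.Binary.Definitions using (DecidableEquality)
open import Relation.Binary.PropositionalEquality using (_≡_; _≢_; refl; sym; trans; cong; cong₂; subst)
open import Relation.Nullary using (Dec; yes; no; contradiction; _×-dec_; _→-dec_)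
open import Relation.Nullary.Decidable using (map′; from-yes)
open import Relation.Unary using (Pred; Decidable; _⊆_; ∁)
open import Relation.Unary.Properties using (_∪?_)

-- Since `P` and `Q` exclude each other, an entry adds at most 1 to the left side, and when it does,
-- `R` holds and the right side grows too.
length-filter-disjoint : ∀ {A : Set} {P Q R : Pred A 0ℓ}
  (P? : Decidable P) (Q? : Decidable Q) (R? : Decidable R) →
  P ⊆ R → Q ⊆ R → P ⊆ ∁ Q → ∀ xs →
  length (filter P? xs) + length (filter Q? xs) ≤ length (filter R? xs)
length-filter-disjoint P? Q? R? P⊆R Q⊆R P⊆∁Q [] = z≤n
length-filter-disjoint P? Q? R? P⊆R Q⊆R P⊆∁Q (x ∷ xs)
  with ih ← length-filter-disjoint P? Q? R? P⊆R Q⊆R P⊆∁Q xs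
  with P? x | Q? x | R? x
... | yes p | yes q | _     = contradiction q (P⊆∁Q p)
... | yes p | no  _ | yes _ = s≤s ih
... | yes p | no  _ | no ¬r = contradiction (P⊆R p) ¬r
... | no  _ | yes q | yes _ = ≤-trans (≤-reflexive (+-suc _ _)) (s≤s ih)
... | no  _ | yes q | no ¬r = contradiction (Q⊆R q) ¬r
... | no  _ | no  _ | yes _ = m≤n⇒m≤1+n ih
... | no  _ | no  _ | no  _ = ih

agree-everywhere⇒≡ : ∀ {x y} → All (Agree x y) attributes → x ≡ y
agree-everywhere⇒≡ (refl ∷ refl ∷ refl ∷ refl ∷ []) = refl

_≟Card_ : DecidableEquality Card
x ≟Card y = map′ agree-everywhere⇒≡ (λ { refl → All.universal (λ _ → refl) _ })
                 (all? (agree? x y) attributes)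

open import Data.List.Relation.Unary.Unique.DecPropositional _≟Card_ using (unique?)

#agree<4 : ∀ {x y} → x ≢ y → # agree? x y < 4
#agree<4 {x} {y} x≢y = filter-notAll (agree? x y) attributes
  (¬All⇒Any¬ (agree? x y) attributes λ all → x≢y (agree-everywhere⇒≡ all))

-- The right side contains the unfolded `sum` of the list of p's, the form in which invariance under
-- permutation applies.
sum-regroup : ∀ t p₁ p₂ p₃ → t + p₁ + p₂ + p₃ ≡ t + (p₁ + (p₂ + (p₃ + 0)))
sum-regroup = solve-∀

-- Stated for a list because the p's are known only up to permutation, and `All` transfers along
-- `↭`.
PairBounds : ℕ → List ℕ → Set
PairBounds t = All (λ p → p + t < 4)

module _ (x₁ x₂ x₃ : Card) where

  private
    t  = # allAgree? x₁ x₂ x₃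
    p₁ = # onlyPairAgrees? x₁ x₂ x₃
    p₂ = # onlyPairAgrees? x₁ x₃ x₂
    p₃ = # onlyPairAgrees? x₂ x₃ x₁

  pair-bounds : Unique (x₁ ∷ x₂ ∷ x₃ ∷ []) → PairBounds t (p₁ ∷ p₂ ∷ p₃ ∷ [])
  pair-bounds ((x₁≢x₂ ∷ x₁≢x₃ ∷ []) ∷ (x₂≢x₃ ∷ []) ∷ [] ∷ []) =
      ≤-<-trans
        (length-filter-disjoint (onlyPairAgrees? x₁ x₂ x₃) (allAgree? x₁ x₂ x₃) (agree? x₁ x₂)
          proj₁ proj₁ proj₂ attributes)
        (#agree<4 x₁≢x₂)
    ∷ ≤-<-trans
        (length-filter-disjoint (onlyPairAgrees? x₁ x₃ x₂) (allAgree? x₁ x₂ x₃) (agree? x₁ x₃)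
          -- The two predicates list the three cards in different orders, so agreement of all three
          -- is rebuilt by symmetry and transitivity.
          proj₁ (λ (e , f) → trans e f) (λ (_ , ¬all) (e , f) → ¬all (trans e f , sym f)) attributes)
        (#agree<4 x₁≢x₃)
    ∷ ≤-<-trans
        (length-filter-disjoint (onlyPairAgrees? x₂ x₃ x₁) (allAgree? x₁ x₂ x₃) (agree? x₂ x₃)
          proj₁ proj₂ (λ (_ , ¬all) (e , f) → ¬all (f , sym (trans e f))) attributes)
        (#agree<4 x₂≢x₃)
    ∷ []

  -- Two different agreeing pairs force all three cards to agree, so the four counted predicates are
  -- disjoint. They are merged one at a time, and the last union counts at most all four attributes.
  total-bound : t + p₁ + p₂ + p₃ ≤ 4
  total-bound =
    ≤-trans (+-monoˡ-≤ p₃ (≤-trans (+-monoˡ-≤ p₂ t+p₁≤) +p₂≤))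
      (≤-trans +p₃≤ (length-filter all-counted? attributes))
    where
    pair₁₂-or-pair₁₃? = agree? x₁ x₂ ∪? onlyPairAgrees? x₁ x₃ x₂
    all-counted? = pair₁₂-or-pair₁₃? ∪? onlyPairAgrees? x₂ x₃ x₁

    t+p₁≤ : t + p₁ ≤ # agree? x₁ x₂
    t+p₁≤ = length-filter-disjoint (allAgree? x₁ x₂ x₃) (onlyPairAgrees? x₁ x₂ x₃) (agree? x₁ x₂)
      proj₁ proj₁ (λ all (_ , ¬all) → ¬all all) attributes

    +p₂≤ : # agree? x₁ x₂ + p₂ ≤ # pair₁₂-or-pair₁₃?
    +p₂≤ = length-filter-disjoint (agree? x₁ x₂) (onlyPairAgrees? x₁ x₃ x₂) pair₁₂-or-pair₁₃?
      inj₁ inj₂ (λ e (f , ¬all) → ¬all (f , trans (sym f) e)) attributes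

    +p₃≤ : # pair₁₂-or-pair₁₃? + p₃ ≤ # all-counted?
    +p₃≤ = length-filter-disjoint pair₁₂-or-pair₁₃? (onlyPairAgrees? x₂ x₃ x₁) all-counted?
      inj₁ inj₂
      [ (λ e (f , ¬all) → ¬all (f , sym (trans e f)))
      , (λ (e , _) (f , ¬all) → ¬all (f , sym e)) ]′
      attributes

-- Only lists with at least four entries matter.
toCard : List (Fin 3) → Card
toCard (c ∷ s ∷ f ∷ n ∷ _) = card
  (lookup (red ∷ green ∷ purple ∷ []) c)
  (lookup (oval ∷ diamond ∷ squiggle ∷ []) s)
  (lookup (solid ∷ empty ∷ stripe ∷ []) f)
  (lookup (single ∷ double ∷ triple ∷ []) n)
toCard _ = card red oval solid single

module Realisation (t p₁ p₂ p₃ : ℕ) where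

  blocks : (a b c d : Fin 3) → Card
  blocks a b c d = toCard
    -- Four copies of `d` always suffice to fill the attributes that the earlier blocks leave free;
    -- `toCard` ignores the surplus.
    (replicate t 0F ++ replicate p₁ a ++ replicate p₂ b ++ replicate p₃ c ++ replicate 4 d)

  y₁ y₂ y₃ : Card
  -- Read by columns: the odd card out is `y₃`, `y₂`, `y₁` in the blocks of `p₁`, `p₂`, `p₃`, and
  -- the last column is 0, 1, 2.
  y₁ = blocks 0F 0F 1F 0F
  y₂ = blocks 0F 1F 0F 1F
  y₃ = blocks 1F 0F 0F 2F

  Realised : Set
  Realised = Unique (y₁ ∷ y₂ ∷ y₃ ∷ [])
    × # allAgree? y₁ y₂ y₃ ≡ t
    × # onlyPairAgrees? y₁ y₂ y₃ ≡ p₁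
    × # onlyPairAgrees? y₁ y₃ y₂ ≡ p₂
    × # onlyPairAgrees? y₂ y₃ y₁ ≡ p₃

  realised? : Dec Realised
  realised? = unique? _ ×-dec (_ ≟ _) ×-dec (_ ≟ _) ×-dec (_ ≟ _) ×-dec (_ ≟ _)

  realised⇒symbol : Realised →
    Σ[ H ∈ Hand ] Σ[ h ∈ HasThreeCards H ] symbol H h ≈ ⟨ t ⨾ p₁ ⨾ p₂ ⨾ p₃ ⟩
  realised⇒symbol (distinct , t≡ , p₁≡ , p₂≡ , p₃≡) =
      (_∈ y₁ ∷ y₂ ∷ y₃ ∷ [])
    , record { distinct = distinct ; elements = id , id }
    , t≡
    , ↭-reflexive (cong₂ _∷_ p₁≡ (cong₂ _∷_ p₂≡ (cong (_∷ []) p₃≡)))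

open Realisation using (Realised; realised?; realised⇒symbol)

-- A finite check by evaluation over 256 tuples. The bounds are premises inside the decided
-- statement, so inadmissible tuples pass vacuously.
bounded⇒realised :
  All (λ t → All (λ p₁ → All (λ p₂ → All (λ p₃ →
    All (λ p → p + t ∈ upTo 4) (p₁ ∷ p₂ ∷ p₃ ∷ []) →
    t + p₁ + p₂ + p₃ ∈ upTo 5 →
    Realised t p₁ p₂ p₃) (upTo 4)) (upTo 4)) (upTo 4)) (upTo 4)
bounded⇒realised = from-yes
  (all? (λ t → all? (λ p₁ → all? (λ p₂ → all? (λ p₃ →
    all? (λ p → p + t ∈? upTo 4) (p₁ ∷ p₂ ∷ p₃ ∷ [])
    →-dec (t + p₁ + p₂ + p₃ ∈? upTo 5)
    →-dec realised? t p₁ p₂ p₃) (upTo 4)) (upTo 4)) (upTo 4)) (upTo 4))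
  where open import Data.List.Membership.DecPropositional _≟_ using (_∈?_)

theorem2 : (t p₁ p₂ p₃ : ℕ) →
    (Σ[ H ∈ Hand ] Σ[ h ∈ HasThreeCards H ] symbol H h ≈ ⟨ t ⨾ p₁ ⨾ p₂ ⨾ p₃ ⟩)
    ⇔
    ( t ∈ 0 ∷ 1 ∷ 2 ∷ 3 ∷ []
    × All (λ p → p ∈ 0 ∷ 1 ∷ 2 ∷ 3 ∷ []) (p₁ ∷ p₂ ∷ p₃ ∷ [])
    × All (λ p → p + t ∈ 0 ∷ 1 ∷ 2 ∷ 3 ∷ []) (p₁ ∷ p₂ ∷ p₃ ∷ [])
    × t + p₁ + p₂ + p₃ ∈ 0 ∷ 1 ∷ 2 ∷ 3 ∷ 4 ∷ [] )
theorem2 t p₁ p₂ p₃ = mk⇔ necessary sufficient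
  where
  necessary : _ → _
  necessary (H , h , refl , ps↭) =
      -- The bounds on `t` and on each single p follow from those on `p + t`; `upTo 4` evaluates to
      -- the literal list of the statement.
      ∈-upTo⁺ (≤-<-trans (m≤n+m t p₁) (All.head bounds))
    , All.map (λ {p} p+t<4 → ∈-upTo⁺ (≤-<-trans (m≤m+n p t) p+t<4)) bounds
    , All.map ∈-upTo⁺ bounds
    , ∈-upTo⁺ (s≤s (subst (_≤ 4) same-total (total-bound x₁ x₂ x₃)))
    where
    open HasThreeCards h

    bounds : PairBounds t (p₁ ∷ p₂ ∷ p₃ ∷ [])
    bounds = All-resp-↭ ps↭ (pair-bounds x₁ x₂ x₃ distinct)

    -- The counts of the hand are a permutation of the given p's, which leaves their sum unchanged.
    same-total : _ ≡ t + p₁ + p₂ + p₃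
    same-total = trans (sum-regroup t _ _ _)
      (trans (cong (t +_) (sum-↭ ps↭)) (sym (sum-regroup t p₁ p₂ p₃)))

  sufficient : _ → _
  sufficient (t∈ , p₁∈ ∷ p₂∈ ∷ p₃∈ ∷ [] , pairs , total) =
    realised⇒symbol t p₁ p₂ p₃
      (All.lookup (All.lookup (All.lookup (All.lookup bounded⇒realised t∈) p₁∈) p₂∈) p₃∈ pairs total)
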